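{- Let $\Omega$ be a monoid, $(K,+)$ a complete monoid, $m:\Omega\to K$ any map and $\bot\subseteq K$ any subset. Then quantitative coherence spaces (defined with respect to $m$ and $\bot$), with duality $A\mapsto A^\perp=(X^A,\mathbf{A}^\perp)$, tensor product $\otimes$ and linear implication $\multimap$ as defined below, form a model of multiplicative linear logic (MLL).
   Context: A triskell over a set $X$ with weights in $\Omega$ is a tuple $(E,X,X,\Omega,s,t,w)$ with $s,t:E\to X$, $w:E\to\Omega$, considered up to isomorphism; composition of triskells over $X$: edges $\{(e,e'):t(e)=s'(e')\}$, source $s(e)$, target $t'(e')$, weight $w(e)w'(e')$. The product $T\times T'$ of triskells over $X$ and $Y$ is the triskell over $X\times Y$ with edges $E\times E'$, maps $s\times s'$, $t\times t'$ and weight $w(e)w'(e')$. A complete monoid is a commutative monoid with sums of arbitrary families. $\mathrm{tr}_m(T)=\sum_{e\in E,s(e)=t(e)}m(w(e))$. Orthogonality: $T\perp T'$ iff $\mathrm{tr}_m(T\circ T')\in\bot$; for a set $\mathbf{A}$ of triskells over $X$, $\mathbf{A}^\perp=\{T : \forall A\in\mathbf{A},\ T\perp A\}$. A quantitative coherence space is a pair $A=(X^A,\mathbf{A})$ of a set $X^A$ and a set $\mathbf{A}$ of triskells over $X^A$ with $\mathbf{A}=\mathbf{A}^{\perp\perp}$. Tensor: $A\otimes B=(X^A\times X^B,\{T\times T' : T\in\mathbf{A},T'\in\mathbf{B}\}^{\perp\perp})$. Application: for $F$ a triskell over $X\times Y$ and $A$ a triskell over $X$, $[F]A$ is the triskell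 over $Y$ with edges the pairs $(f,a)$ such that $f$ goes from $(x,y)$ to $(x',y')$ in $F$ and $a$ goes from $x$ to $x'$ in $A$, source $\pi_Y(s(f))$, target $\pi_Y(t(f))$, weight $w(f)w(a)$. Linear implication: $A\multimap B=(X^A\times X^B,\{F \text{ triskell over } X^A\times X^B : \forall A'\in\mathbf{A},\ [F]A'\in\mathbf{B}\})$.
   Formalization: The monoid Ω is assumed commutative; for non-commutative Ω the claim fails: with ⊥ = K the tensor unit is isomorphic to the one-point space, whose endomorphisms (Ω-weighted sets under product) would have to commute. -}

module Defs where

open import Level using (Level; _⊔_; suc; Lift)
open import Algebra.Bundles using (Monoid; CommutativeMonoid)
open import Data.Bool.Base using (Bool; true; false)
open import Data.Empty.Polymorphic using (⊥)
open import Data.Product.Base using (Σ; ∃₂; _×_; _,_; proj₁; proj₂; uncurry)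
open import Data.Unit.Polymorphic using (⊤; tt)
open import Function.Base using (_∘_)
open import Function.Bundles using (Func; _↔_; Inverse)
open import Relation.Binary.Core using (Rel)
open import Relation.Binary.Structures using (IsEquivalence)
open import Relation.Binary.PropositionalEquality.Core using (_≡_)
open import Relation.Unary using (Pred; _∈_; _≐_)

-- Families are indexed by the types of level a, the level at which webs and
-- edge sets live; summation by an arbitrary partition of the index set is the
-- combination of ∑-↔ and ∑-Σ.

record CompleteMonoid (a k ℓ : Level) : Set (suc (a ⊔ k ⊔ ℓ)) where
  field
    commutativeMonoid : CommutativeMonoid k ℓ

  open CommutativeMonoid commutativeMonoid public
    renaming (_∙_ to _+_; ε to 0#; ∙-cong to +-cong)

  field
    ∑      : {I : Set a} → (I → Carrier) → Carrier
    ∑-cong : {I : Set a} {f g : I → Carrier} → (∀ i → f i ≈ g i) → ∑ f ≈ ∑ g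
    ∑-↔    : {I J : Set a} (φ : I ↔ J) (f : J → Carrier) →
             ∑ (f ∘ Inverse.to φ) ≈ ∑ f
    ∑-⊥    : (f : ⊥ → Carrier) → ∑ f ≈ 0#
    ∑-⊤    : (f : ⊤ → Carrier) → ∑ f ≈ f tt
    ∑-Bool : (f : Lift a Bool → Carrier) →
             ∑ f ≈ f (Level.lift false) + f (Level.lift true)
    ∑-Σ    : {I : Set a} {J : I → Set a} (f : (i : I) → J i → Carrier) →
             ∑ (λ i → ∑ (f i)) ≈ ∑ {I = Σ I J} (uncurry f)

-- A model of MLL is a *-autonomous category.  The tensor, the internal hom and
-- the duality on objects are parameters below, so that they can be prescribed.

record RawCategory (o h e : Level) : Set (suc (o ⊔ h ⊔ e)) where
  infix  4 _≈_ _⇒_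
  infixr 9 _⊙_
  field
    Obj : Set o
    _⇒_ : Obj → Obj → Set h
    _≈_ : ∀ {A B} → Rel (A ⇒ B) e
    id  : ∀ {A} → A ⇒ A
    _⊙_ : ∀ {A B C} → B ⇒ C → A ⇒ B → A ⇒ C

  record IsIso {A B : Obj} (f : A ⇒ B) : Set (h ⊔ e) where
    field
      inv  : B ⇒ A
      invˡ : inv ⊙ f ≈ id
      invʳ : f ⊙ inv ≈ id

record IsCategory {o h e} (𝒞 : RawCategory o h e) : Set (o ⊔ h ⊔ e) where
  open RawCategory 𝒞
  field
    equiv     : ∀ {A B} → IsEquivalence (_≈_ {A} {B})
    ⊙-cong    : ∀ {A B C} {g g′ : B ⇒ C} {f f′ : A ⇒ B} →
                g ≈ g′ → f ≈ f′ → g ⊙ f ≈ g′ ⊙ f′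
    assoc     : ∀ {A B C D} {f : A ⇒ B} {g : B ⇒ C} {h : C ⇒ D} →
                (h ⊙ g) ⊙ f ≈ h ⊙ (g ⊙ f)
    identityˡ : ∀ {A B} {f : A ⇒ B} → id ⊙ f ≈ f
    identityʳ : ∀ {A B} {f : A ⇒ B} → f ⊙ id ≈ f

record IsSymmetricMonoidal {o h e} (𝒞 : RawCategory o h e)
  (_⊗_ : RawCategory.Obj 𝒞 → RawCategory.Obj 𝒞 → RawCategory.Obj 𝒞) :
  Set (o ⊔ h ⊔ e) where
  open RawCategory 𝒞
  infixr 10 _⊗₁_
  field
    _⊗₁_   : ∀ {A A′ B B′} → A ⇒ B → A′ ⇒ B′ → (A ⊗ A′) ⇒ (B ⊗ B′)
    ⊗-cong : ∀ {A A′ B B′} {f g : A ⇒ B} {f′ g′ : A′ ⇒ B′} →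
             f ≈ g → f′ ≈ g′ → f ⊗₁ f′ ≈ g ⊗₁ g′
    ⊗-id   : ∀ {A B} → id {A} ⊗₁ id {B} ≈ id
    ⊗-⊙    : ∀ {A A′ B B′ C C′} {f : A ⇒ B} {g : B ⇒ C}
             {f′ : A′ ⇒ B′} {g′ : B′ ⇒ C′} →
             (g ⊙ f) ⊗₁ (g′ ⊙ f′) ≈ (g ⊗₁ g′) ⊙ (f ⊗₁ f′)

    𝟏 : Obj
    α : ∀ {A B C} → ((A ⊗ B) ⊗ C) ⇒ (A ⊗ (B ⊗ C))
    λˡ : ∀ {A} → (𝟏 ⊗ A) ⇒ A
    ρ : ∀ {A} → (A ⊗ 𝟏) ⇒ A
    σ : ∀ {A B} → (A ⊗ B) ⇒ (B ⊗ A)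

    α-iso : ∀ {A B C} → IsIso (α {A} {B} {C})
    λˡ-iso : ∀ {A} → IsIso (λˡ {A})
    ρ-iso : ∀ {A} → IsIso (ρ {A})

    α-natural : ∀ {A A′ B B′ C C′} {f : A ⇒ A′} {g : B ⇒ B′} {h : C ⇒ C′} →
                α ⊙ ((f ⊗₁ g) ⊗₁ h) ≈ (f ⊗₁ (g ⊗₁ h)) ⊙ α
    λˡ-natural : ∀ {A B} {f : A ⇒ B} → λˡ ⊙ (id ⊗₁ f) ≈ f ⊙ λˡ
    ρ-natural : ∀ {A B} {f : A ⇒ B} → ρ ⊙ (f ⊗₁ id) ≈ f ⊙ ρ
    σ-natural : ∀ {A A′ B B′} {f : A ⇒ A′} {g : B ⇒ B′} →
                σ ⊙ (f ⊗₁ g) ≈ (g ⊗₁ f) ⊙ σ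

    triangle   : ∀ {A B} → (id {A} ⊗₁ λˡ {B}) ⊙ α ≈ ρ ⊗₁ id
    pentagon   : ∀ {A B C D} →
                 (id {A} ⊗₁ α {B} {C} {D}) ⊙ (α ⊙ (α ⊗₁ id)) ≈ α ⊙ α
    hexagon    : ∀ {A B C} →
                 (id {B} ⊗₁ σ {A} {C}) ⊙ (α ⊙ (σ {A} {B} ⊗₁ id {C})) ≈
                 α ⊙ (σ ⊙ α)
    involutive : ∀ {A B} → σ {B} {A} ⊙ σ {A} {B} ≈ id

record IsStarAutonomous {o h e} (𝒞 : RawCategory o h e)
  (_⊗_ _⊸_ : RawCategory.Obj 𝒞 → RawCategory.Obj 𝒞 → RawCategory.Obj 𝒞)
  (_* : RawCategory.Obj 𝒞 → RawCategory.Obj 𝒞) : Set (o ⊔ h ⊔ e) where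
  open RawCategory 𝒞
  field
    isCategory          : IsCategory 𝒞
    isSymmetricMonoidal : IsSymmetricMonoidal 𝒞 _⊗_
  open IsSymmetricMonoidal isSymmetricMonoidal public

  field
    eval         : ∀ {A B} → ((A ⊸ B) ⊗ A) ⇒ B
    curry        : ∀ {A B C} → (C ⊗ A) ⇒ B → C ⇒ (A ⊸ B)
    curry-β      : ∀ {A B C} {f : (C ⊗ A) ⇒ B} → eval ⊙ (curry f ⊗₁ id) ≈ f
    curry-unique : ∀ {A B C} {f : (C ⊗ A) ⇒ B} {g : C ⇒ (A ⊸ B)} →
                   eval ⊙ (g ⊗₁ id) ≈ f → g ≈ curry f

  -- The canonical map to the bidual with respect to 𝟏 * is invertible, and the
  -- prescribed A * is the dual of A with respect to 𝟏 *.
  field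
    dualising : ∀ {A} → IsIso (curry (eval {A} {𝟏 *} ⊙ σ))
    *-⇒⊸      : ∀ {A} → (A *) ⇒ (A ⊸ (𝟏 *))
    *-⇒⊸-iso  : ∀ {A} → IsIso (*-⇒⊸ {A})

-- Axiom K is in force, so every type is a set and edge sets such as
-- {(e , e′) ∣ t e ≡ s′ e′} carry no extra multiplicity.

module Triskells {c ℓ : Level} (a : Level) (Ω : Monoid c ℓ) where
  open Monoid Ω using (Carrier; _∙_; ε) renaming (_≈_ to _≈Ω_)

  record Triskell (X : Set a) : Set (suc a ⊔ c) where
    field
      Edge : Set a
      s t  : Edge → X
      w    : Edge → Carrier
  open Triskell public

  infix 4 _≅_
  record _≅_ {X : Set a} (T T′ : Triskell X) : Set (a ⊔ ℓ) where
    field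
      edges : Edge T ↔ Edge T′
      s-≡   : ∀ e → s T′ (Inverse.to edges e) ≡ s T e
      t-≡   : ∀ e → t T′ (Inverse.to edges e) ≡ t T e
      w-≈   : ∀ e → w T′ (Inverse.to edges e) ≈Ω w T e

  infixr 9 _∘ₜ_
  _∘ₜ_ : {X : Set a} → Triskell X → Triskell X → Triskell X
  T ∘ₜ T′ = record
    { Edge = Σ (Edge T × Edge T′) λ (e , e′) → t T e ≡ s T′ e′
    ; s    = λ ((e , _) , _) → s T e
    ; t    = λ ((_ , e′) , _) → t T′ e′
    ; w    = λ ((e , e′) , _) → w T e ∙ w T′ e′
    }

  infixr 10 _×ₜ_
  _×ₜ_ : {X Y : Set a} → Triskell X → Triskell Y → Triskell (X × Y)
  T ×ₜ T′ = record
    { Edge = Edge T × Edge T′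
    ; s    = λ (e , e′) → s T e , s T′ e′
    ; t    = λ (e , e′) → t T e , t T′ e′
    ; w    = λ (e , e′) → w T e ∙ w T′ e′
    }

  -- The argument is used covariantly (e goes from x to x′, like f), whereas in
  -- tr (F ∘ₜ A) the edge of A goes backwards: A ⊸ B and (A ⊗ B^⊥)^⊥ agree up
  -- to transposition in A, that is up to isomorphism rather than on the nose.
  [_]_ : {X Y : Set a} → Triskell (X × Y) → Triskell X → Triskell Y
  [ F ] A = record
    { Edge = Σ (Edge F × Edge A) λ (f , e) →
             proj₁ (s F f) ≡ s A e × proj₁ (t F f) ≡ t A e
    ; s    = λ ((f , _) , _) → proj₂ (s F f)
    ; t    = λ ((f , _) , _) → proj₂ (t F f)
    ; w    = λ ((f , e) , _) → w F f ∙ w A e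
    }

  -- The identity and the composition of the category of triskells, where a
  -- triskell over X × Y is a morphism from X to Y.  They are the ones
  -- satisfying [ Idₜ ] A ≅ A and [ G ⊙ₜ F ] A ≅ [ G ] ([ F ] A).

  Idₜ : (X : Set a) → Triskell (X × X)
  Idₜ X = record
    { Edge = X × X
    ; s    = λ (x , _) → x , x
    ; t    = λ (_ , x′) → x′ , x′
    ; w    = λ _ → ε
    }

  infixr 9 _⊙ₜ_
  _⊙ₜ_ : {X Y Z : Set a} →
         Triskell (Y × Z) → Triskell (X × Y) → Triskell (X × Z)
  G ⊙ₜ F = record
    { Edge = Σ (Edge G × Edge F) λ (g , f) →
             proj₁ (s G g) ≡ proj₂ (s F f) × proj₁ (t G g) ≡ proj₂ (t F f)
    ; s    = λ ((g , f) , _) → proj₁ (s F f) , proj₂ (s G g)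
    ; t    = λ ((g , f) , _) → proj₁ (t F f) , proj₂ (t G g)
    ; w    = λ ((g , f) , _) → w G g ∙ w F f
    }

-- Pole is the subset ⊥ of K.

module QuantitativeCoherence {c ℓ a k ℓK p : Level}
  (Ω : Monoid c ℓ) (K : CompleteMonoid a k ℓK)
  (m : Func (Monoid.setoid Ω) (CompleteMonoid.setoid K))
  (Pole : Pred (CompleteMonoid.Carrier K) p) where

  open Triskells a Ω public
  open CompleteMonoid K using (∑) renaming (Carrier to |K|)

  tr : {X : Set a} → Triskell X → |K|
  tr T = ∑ {I = Σ (Edge T) λ e → s T e ≡ t T e} λ (e , _) → Func.to m (w T e)

  infix 4 _⊥ₜ_
  _⊥ₜ_ : {X : Set a} → Triskell X → Triskell X → Set p
  T ⊥ₜ T′ = tr (T ∘ₜ T′) ∈ Pole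

  -- The level of sets of triskells; it is stable under taking orthogonals.
  L : Level
  L = suc a ⊔ c ⊔ ℓ ⊔ p

  infix 11 _^⊥
  _^⊥ : {X : Set a} → Pred (Triskell X) L → Pred (Triskell X) L
  (𝐀 ^⊥) T = ∀ A → A ∈ 𝐀 → T ⊥ₜ A

  record Space : Set (suc L) where
    constructor ⟨_,_⟩
    field
      Web : Set a
      Set𝐀 : Pred (Triskell Web) L
  open Space public

  -- Invariance of the set of triskells under _≅_ is a consequence.
  IsQCS : Space → Set L
  IsQCS A = Set𝐀 A ≐ (Set𝐀 A ^⊥) ^⊥

  QCS : Set (suc L)
  QCS = Σ Space IsQCS

  dual : Space → Space
  dual A = ⟨ Web A , Set𝐀 A ^⊥ ⟩

  infixr 10 _⊗_
  _⊗_ : Space → Space → Space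
  A ⊗ B = ⟨ Web A × Web B , (products ^⊥) ^⊥ ⟩
    where
    products : Pred (Triskell (Web A × Web B)) L
    products U = ∃₂ λ T T′ → T ∈ Set𝐀 A × T′ ∈ Set𝐀 B × U ≅ T ×ₜ T′

  infixr 9 _⊸_
  _⊸_ : Space → Space → Space
  A ⊸ B = ⟨ Web A × Web B , (λ F → ∀ A′ → A′ ∈ Set𝐀 A → [ F ] A′ ∈ Set𝐀 B) ⟩

  -- Nothing up to here uses commutativity of Ω, but ⊸-closed and the
  -- functoriality of the tensor can fail without it.
  record IsModelOfMLL : Set (suc L) where
    field
      dual-closed : ∀ {A} → IsQCS A → IsQCS (dual A)
      ⊗-closed    : ∀ {A B} → IsQCS A → IsQCS B → IsQCS (A ⊗ B)
      ⊸-closed    : ∀ {A B} → IsQCS A → IsQCS B → IsQCS (A ⊸ B)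
      Id-closed   : ∀ {A} → IsQCS A → Idₜ (Web A) ∈ Set𝐀 (A ⊸ A)
      ⊙-closed    : ∀ {A B C} → IsQCS A → IsQCS B → IsQCS C → ∀ {F G} →
                    G ∈ Set𝐀 (B ⊸ C) → F ∈ Set𝐀 (A ⊸ B) →
                    G ⊙ₜ F ∈ Set𝐀 (A ⊸ C)

    category : RawCategory (suc L) L (a ⊔ ℓ)
    category = record
      { Obj = QCS
      ; _⇒_ = λ (A , _) (B , _) → Σ (Triskell (Web A × Web B)) (Set𝐀 (A ⊸ B))
      ; _≈_ = λ (F , _) (G , _) → F ≅ G
      ; id  = λ {(A , qA)} → Idₜ (Web A) , Id-closed qA
      ; _⊙_ = λ {(A , qA)} {(B , qB)} {(C , qC)} (G , G∈) (F , F∈) →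
              G ⊙ₜ F , ⊙-closed {A} {B} {C} qA qB qC G∈ F∈
      }

    field
      isStarAutonomous : IsStarAutonomous category
        (λ (A , qA) (B , qB) → A ⊗ B , ⊗-closed qA qB)
        (λ (A , qA) (B , qB) → A ⊸ B , ⊸-closed qA qB)
        (λ (A , qA) → dual A , dual-closed qA)

{-# OPTIONS --safe #-}
module Submission where

-- A triskell over X × Y is a matrix of weighted sets from X × X to Y × Y, so
-- triskells form a compact closed category in which the application [ F ] A,
-- the trace pairing and all the structural morphisms are composites of
-- reindexed identities.  An equation between morphisms is therefore a bijection
-- of edges, and so is each identity ⟨ T , [ F ] U ⟩ = ⟨ [ F° ] T , U ⟩ between
-- pairings.  The latter says that F maps 𝐒^⊥⊥ into a bipolar-closed set as soon as
-- it maps 𝐒 into it; hence membership in a hom-set out of a tensor product is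
-- tested on products, where each structural morphism is evaluated directly.

open import Level using (Level; Lift; lift)
open import Algebra.Bundles using (Monoid; CommutativeMonoid)
open import Algebra.Definitions using (Commutative)
import Algebra.Properties.CommutativeSemigroup as CommutativeSemigroupProperties
open import Axiom.UniquenessOfIdentityProofs.WithK using (uip)
open import Data.Product.Base using (Σ; _×_; _,_; proj₁; proj₂; map; swap; assocʳ′; assocˡ′)
open import Data.Product.Function.NonDependent.Propositional using (_×-↔_)
open import Data.Unit.Polymorphic using (⊤; tt)
open import Function.Base using (_∘_; id)
open import Function.Bundles using (Func; _↔_; Inverse; mk↔ₛ′)
open import Function.Construct.Composition using (_↔-∘_)
open import Function.Construct.Identity using (↔-id)
open import Function.Construct.Symmetry using (↔-sym)
open import Relation.Binary.Definitions using (_Respects_)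
open import Relation.Binary.PropositionalEquality.Core using (_≡_; refl; sym; trans; cong; cong₂)
open import Relation.Nullary.Irrelevant using (Irrelevant)
open import Relation.Unary using (Pred; _∈_; _⊆_)
open import Defs

-- Irrelevance of equality proofs.

private
  variable
    i j : Level
    I J : Set i

  pair-uip : {x y : I} {u v : J} → Irrelevant (x ≡ y × u ≡ v)
  pair-uip (p , q) (p′ , q′) = cong₂ _,_ (uip p p′) (uip q q′)

  -- Edges of a composite carry matching proofs; since these are irrelevant, two such edges agree as
  -- soon as the edges they combine do.
  Σ-≡ : {P : I → Set j} → (∀ {x} → Irrelevant (P x)) →
        {u v : Σ I P} → proj₁ u ≡ proj₁ v → u ≡ v
  Σ-≡ irr {x , p} {.x , q} refl = cong (x ,_) (irr p q)

module TriskellProperties {c ℓ : Level} (a : Level) (Ω : Monoid c ℓ)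
  (comm : Commutative (Monoid._≈_ Ω) (Monoid._∙_ Ω)) where

  open Triskells a Ω
  open Monoid Ω using (_∙_; ∙-cong; isMonoid; identityˡ; identityʳ; assoc)
    renaming (_≈_ to _≈Ω_; refl to ≈-refl; sym to ≈-sym; trans to ≈-trans)

  Ω-commutativeMonoid : CommutativeMonoid c ℓ
  Ω-commutativeMonoid = record
    { isCommutativeMonoid = record { isMonoid = isMonoid ; comm = comm } }

  open CommutativeSemigroupProperties
    (CommutativeMonoid.commutativeSemigroup Ω-commutativeMonoid)
    using (interchange; xy∙z≈y∙zx)

  variable
    X Y Z X′ Y′ Z′ : Set a
    T U : Triskell X

  -- Isomorphism and reindexing of triskells.

  ≅-refl : T ≅ T
  ≅-refl = record
    { edges = ↔-id _ ; s-≡ = λ _ → refl ; t-≡ = λ _ → refl ; w-≈ = λ _ → ≈-refl }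

  ≅-sym : T ≅ U → U ≅ T
  ≅-sym {T = T} {U} φ = record
    { edges = ↔-sym edges
    ; s-≡ = λ e → trans (sym (s-≡ (from e))) (cong (s U) (strictlyInverseˡ e))
    ; t-≡ = λ e → trans (sym (t-≡ (from e))) (cong (t U) (strictlyInverseˡ e))
    ; w-≈ = λ e → ≈-trans (≈-sym (w-≈ (from e)))
              (Monoid.reflexive Ω (cong (w U) (strictlyInverseˡ e)))
    }
    where
    open _≅_ φ
    open Inverse edges

  ≅-trans : {T U V : Triskell X} → T ≅ U → U ≅ V → T ≅ V
  ≅-trans φ ψ = record
    { edges = _≅_.edges ψ ↔-∘ _≅_.edges φ
    ; s-≡ = λ e → trans (_≅_.s-≡ ψ _) (_≅_.s-≡ φ e)
    ; t-≡ = λ e → trans (_≅_.t-≡ ψ _) (_≅_.t-≡ φ e)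
    ; w-≈ = λ e → ≈-trans (_≅_.w-≈ ψ _) (_≅_.w-≈ φ e)
    }

  -- The map acts jointly on source and target, so that exchanging the two, as duality requires, is
  -- also a reindexing.
  reindex : (X × X → Y × Y) → Triskell X → Triskell Y
  reindex φ T = record
    { Edge = Edge T
    ; s    = λ e → proj₁ (φ (s T e , t T e))
    ; t    = λ e → proj₂ (φ (s T e , t T e))
    ; w    = w T
    }

  reindex-cong : (φ : X × X → Y × Y) → T ≅ U → reindex φ T ≅ reindex φ U
  reindex-cong φ ψ = record
    { edges = edges
    ; s-≡ = λ e → cong (proj₁ ∘ φ) (cong₂ _,_ (s-≡ e) (t-≡ e))
    ; t-≡ = λ e → cong (proj₂ ∘ φ) (cong₂ _,_ (s-≡ e) (t-≡ e))
    ; w-≈ = w-≈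
    }
    where open _≅_ ψ

  pair : (X → Y) → X × X → Y × Y
  pair f = map f f

  first : (X × X → X′ × X′) → (X × Y) × (X × Y) → (X′ × Y) × (X′ × Y)
  first φ ((x , y) , (x′ , y′)) = let u , u′ = φ (x , x′) in (u , y) , (u′ , y′)

  second : (Y × Y → Y′ × Y′) → (X × Y) × (X × Y) → (X × Y′) × (X × Y′)
  second φ ((x , y) , (x′ , y′)) = let u , u′ = φ (y , y′) in (x , u) , (x′ , u′)

  -- The morphism permuting pairs (source , target) by φ; a map of webs f acts
  -- through pair f, whereas the duality involves swap.
  graph : (X × X → Y × Y) → Triskell (X × Y)
  graph φ = reindex (second φ) (Idₜ _)

  -- Composition and the category laws.

  module _ {G G′ : Triskell (Y × Z)} {F F′ : Triskell (X × Y)} where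
    ⊙-cong-to : G ≅ G′ → F ≅ F′ → Edge (G ⊙ₜ F) → Edge (G′ ⊙ₜ F′)
    ⊙-cong-to γ φ ((g , f) , p , q) = (Inverse.to γ.edges g , Inverse.to φ.edges f) ,
      trans (cong proj₁ (γ.s-≡ g)) (trans p (sym (cong proj₂ (φ.s-≡ f)))) ,
      trans (cong proj₁ (γ.t-≡ g)) (trans q (sym (cong proj₂ (φ.t-≡ f))))
      where
      module γ = _≅_ γ
      module φ = _≅_ φ

  ⊙-cong : {G G′ : Triskell (Y × Z)} {F F′ : Triskell (X × Y)} →
           G ≅ G′ → F ≅ F′ → G ⊙ₜ F ≅ G′ ⊙ₜ F′
  ⊙-cong γ φ = record
    { edges = mk↔ₛ′ (⊙-cong-to γ φ) (⊙-cong-to (≅-sym γ) (≅-sym φ))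
        (λ _ → Σ-≡ pair-uip (strictlyInverseˡ _))
        (λ _ → Σ-≡ pair-uip (strictlyInverseʳ _))
    ; s-≡ = λ ((g , f) , _) → cong₂ _,_ (cong proj₁ (φ.s-≡ f)) (cong proj₂ (γ.s-≡ g))
    ; t-≡ = λ ((g , f) , _) → cong₂ _,_ (cong proj₁ (φ.t-≡ f)) (cong proj₂ (γ.t-≡ g))
    ; w-≈ = λ ((g , f) , _) → ∙-cong (γ.w-≈ g) (φ.w-≈ f)
    }
    where
    module γ = _≅_ γ
    module φ = _≅_ φ
    open Inverse (γ.edges ×-↔ φ.edges)

  ⊙-assoc : {F : Triskell (X × Y)} {G : Triskell (Y × Z)} {H : Triskell (Z × X′)} →
            (H ⊙ₜ G) ⊙ₜ F ≅ H ⊙ₜ (G ⊙ₜ F)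
  ⊙-assoc = record
    { edges = mk↔ₛ′
        (λ ((((h , g) , p , q) , f) , p′ , q′) → (h , ((g , f) , p′ , q′)) , p , q)
        (λ ((h , ((g , f) , p′ , q′)) , p , q) → (((h , g) , p , q) , f) , p′ , q′)
        (λ _ → refl) (λ _ → refl)
    ; s-≡ = λ _ → refl
    ; t-≡ = λ _ → refl
    ; w-≈ = λ _ → ≈-sym (assoc _ _ _)
    }

  -- `Idₜ` has exactly one edge for each source and target, so the matching equations force its edge
  -- once `f` is given.
  ⊙-identityˡ : {F : Triskell (X × Y)} → Idₜ Y ⊙ₜ F ≅ F
  ⊙-identityˡ = record
    { edges = mk↔ₛ′ (λ ((_ , f) , _) → f) (λ f → (_ , f) , refl , refl)
        (λ _ → refl) (λ { (_ , refl , refl) → refl })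
    ; s-≡ = λ { (_ , refl , refl) → refl }
    ; t-≡ = λ { (_ , refl , refl) → refl }
    ; w-≈ = λ _ → ≈-sym (identityˡ _)
    }

  ⊙-identityʳ : {F : Triskell (X × Y)} → F ⊙ₜ Idₜ X ≅ F
  ⊙-identityʳ = record
    { edges = mk↔ₛ′ (λ ((f , _) , _) → f) (λ f → (f , _) , refl , refl)
        (λ _ → refl) (λ { (_ , refl , refl) → refl })
    ; s-≡ = λ { (_ , refl , refl) → refl }
    ; t-≡ = λ { (_ , refl , refl) → refl }
    ; w-≈ = λ _ → ≈-sym (identityʳ _)
    }

  -- Reindexing an end commutes with composition definitionally.
  graph-⊙ : {F : Triskell (X × Y)} (φ : Y × Y → Z × Z) →
            graph φ ⊙ₜ F ≅ reindex (second φ) F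
  graph-⊙ φ = reindex-cong (second φ) ⊙-identityˡ

  -- Reindexing `graph φ` along `second ψ` gives `graph (ψ ∘ φ)` by computation. Equations between
  -- composites of graphs thus become equations between functions.
  graph-∘ : (φ : X × X → Y × Y) (ψ : Y × Y → Z × Z) →
            graph ψ ⊙ₜ graph φ ≅ graph (ψ ∘ φ)
  graph-∘ φ ψ = graph-⊙ ψ

  module _ (f : X → Y) (g : Y → X) (gf : ∀ x → g (f x) ≡ x) (fg : ∀ y → f (g y) ≡ y) where
    -- The pairs (x , f x) are the pairs (g y , y). Reading the graph from its other end turns
    -- precomposition into a reindexing, as `graph-⊙` does for postcomposition.
    graph-transpose : graph (pair f) ≅ reindex (first (pair g)) (Idₜ Y)
    graph-transpose = record
      { edges = mk↔ₛ′ (pair f) (pair g)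
          (λ (y , y′) → cong₂ _,_ (fg y) (fg y′)) (λ (x , x′) → cong₂ _,_ (gf x) (gf x′))
      ; s-≡ = λ (x , _) → cong (_, f x) (gf x)
      ; t-≡ = λ (_ , x) → cong (_, f x) (gf x)
      ; w-≈ = λ _ → ≈-refl
      }

    ⊙-graph : {F : Triskell (Y × Z)} → F ⊙ₜ graph (pair f) ≅ reindex (first (pair g)) F
    ⊙-graph = ≅-trans (⊙-cong ≅-refl graph-transpose)
      (reindex-cong (first (pair g)) ⊙-identityʳ)

  -- A triskell over X is a morphism from ⊤ to X, and then [ F ] A is the
  -- composite F ⊙ₜ elem A, definitionally.
  elem : Triskell X → Triskell (⊤ {a} × X)
  elem = reindex (pair (tt ,_))

  []-cong : {F G : Triskell (X × Y)} → F ≅ G → T ≅ U → [ F ] T ≅ [ G ] U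
  []-cong φ ψ = reindex-cong (pair proj₂) (⊙-cong φ (reindex-cong (pair (tt ,_)) ψ))

  -- Application is composition with `elem T`, so this is an instance of associativity.
  []-⊙ : {F : Triskell (X × Y)} {G : Triskell (Y × Z)} → [ G ⊙ₜ F ] T ≅ [ G ] ([ F ] T)
  []-⊙ {T = T} {F = F} = reindex-cong (pair proj₂) (⊙-assoc {F = elem T} {G = F})

  []-Id : [ Idₜ X ] T ≅ T
  []-Id {T = T} = reindex-cong (pair proj₂) (⊙-identityˡ {F = elem T})

  []-graph : (φ : X × X → Y × Y) → [ graph φ ] T ≅ reindex φ T
  []-graph φ = reindex-cong φ []-Id

  -- The tensor product on morphisms.

  exchange : (X × Y) × (X′ × Y′) → (X × X′) × (Y × Y′)
  exchange ((x , y) , (x′ , y′)) = (x , x′) , (y , y′)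

  infixr 10 _⊗ₜ_
  _⊗ₜ_ : Triskell (X × Y) → Triskell (X′ × Y′) → Triskell ((X × X′) × (Y × Y′))
  F ⊗ₜ G = reindex (pair exchange) (F ×ₜ G)

  ×ₜ-cong : {T T′ : Triskell X} {U U′ : Triskell Y} →
            T ≅ T′ → U ≅ U′ → T ×ₜ U ≅ T′ ×ₜ U′
  ×ₜ-cong φ ψ = record
    { edges = φ.edges ×-↔ ψ.edges
    ; s-≡ = λ (e , e′) → cong₂ _,_ (φ.s-≡ e) (ψ.s-≡ e′)
    ; t-≡ = λ (e , e′) → cong₂ _,_ (φ.t-≡ e) (ψ.t-≡ e′)
    ; w-≈ = λ (e , e′) → ∙-cong (φ.w-≈ e) (ψ.w-≈ e′)
    }
    where
    module φ = _≅_ φ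
    module ψ = _≅_ ψ

  ⊗-cong : {F F′ : Triskell (X × Y)} {G G′ : Triskell (X′ × Y′)} →
           F ≅ F′ → G ≅ G′ → F ⊗ₜ G ≅ F′ ⊗ₜ G′
  ⊗-cong φ ψ = reindex-cong (pair exchange) (×ₜ-cong φ ψ)

  ⊗-id : Idₜ X ⊗ₜ Idₜ Y ≅ Idₜ (X × Y)
  ⊗-id = record
    { edges = mk↔ₛ′ (λ ((x , x′) , (y , y′)) → (x , y) , (x′ , y′))
        (λ ((x , y) , (x′ , y′)) → (x , x′) , (y , y′)) (λ _ → refl) (λ _ → refl)
    ; s-≡ = λ _ → refl
    ; t-≡ = λ _ → refl
    ; w-≈ = λ _ → ≈-sym (identityˡ _)
    }

  -- An equation between pairs is a pair of equations, which gives the bijection of edges. The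
  -- weights agree by (ab)(cd) = (ac)(bd), which rests on commutativity of Ω.
  ⊗-⊙ : {F : Triskell (X × Y)} {G : Triskell (Y × Z)}
        {F′ : Triskell (X′ × Y′)} {G′ : Triskell (Y′ × Z′)} →
        (G ⊙ₜ F) ⊗ₜ (G′ ⊙ₜ F′) ≅ (G ⊗ₜ G′) ⊙ₜ (F ⊗ₜ F′)
  ⊗-⊙ = record
    { edges = mk↔ₛ′
        (λ (((g , f) , p , q) , ((g′ , f′) , p′ , q′)) →
          ((g , g′) , (f , f′)) , cong₂ _,_ p p′ , cong₂ _,_ q q′)
        (λ (((g , g′) , (f , f′)) , p , q) →
          ((g , f) , cong proj₁ p , cong proj₁ q) , ((g′ , f′) , cong proj₂ p , cong proj₂ q))
        (λ _ → Σ-≡ pair-uip refl)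
        (λ _ → cong₂ _,_ (Σ-≡ pair-uip refl) (Σ-≡ pair-uip refl))
    ; s-≡ = λ _ → refl
    ; t-≡ = λ _ → refl
    ; w-≈ = λ _ → interchange _ _ _ _
    }

  -- This is functoriality of the tensor at the morphisms `elem T` and `elem U`.
  []-⊗ : {F : Triskell (X × Y)} {G : Triskell (X′ × Y′)} →
         [ F ⊗ₜ G ] (T ×ₜ U) ≅ [ F ] T ×ₜ [ G ] U
  []-⊗ {T = T} {U = U} {F = F} {G} = reindex-cong (pair proj₂)
    (≅-sym (⊗-⊙ {F = elem T} {G = F} {F′ = elem U} {G′ = G}))

  graph-⊗ : (f : X → Y) (g : X′ → Y′) →
            graph (pair f) ⊗ₜ graph (pair g) ≅ graph (pair (map f g))
  graph-⊗ f g = reindex-cong (second (pair (map f g))) ⊗-id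

  ×ₜ-assoc : {V : Triskell Z} → reindex (pair assocʳ′) ((T ×ₜ U) ×ₜ V) ≅ T ×ₜ (U ×ₜ V)
  ×ₜ-assoc = record
    { edges = mk↔ₛ′ assocʳ′ assocˡ′ (λ _ → refl) (λ _ → refl)
    ; s-≡ = λ _ → refl
    ; t-≡ = λ _ → refl
    ; w-≈ = λ _ → ≈-sym (assoc _ _ _)
    }

  ×ₜ-comm : reindex (pair swap) (T ×ₜ U) ≅ U ×ₜ T
  ×ₜ-comm = record
    { edges = mk↔ₛ′ swap swap (λ _ → refl) (λ _ → refl)
    ; s-≡ = λ _ → refl
    ; t-≡ = λ _ → refl
    ; w-≈ = λ _ → comm _ _
    }

  -- `graph-⊙` and `⊙-graph` turn both sides into reindexings of products, leaving only a
  -- rebracketing of edges. The other naturality laws follow the same pattern.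
  assoc-natural : {F : Triskell (X × X′)} {G : Triskell (Y × Y′)} {H : Triskell (Z × Z′)} →
    graph (pair assocʳ′) ⊙ₜ ((F ⊗ₜ G) ⊗ₜ H) ≅ (F ⊗ₜ (G ⊗ₜ H)) ⊙ₜ graph (pair assocʳ′)
  assoc-natural = ≅-trans (graph-⊙ _) (≅-trans
    (record
      { edges = mk↔ₛ′ assocʳ′ assocˡ′ (λ _ → refl) (λ _ → refl)
      ; s-≡ = λ _ → refl
      ; t-≡ = λ _ → refl
      ; w-≈ = λ _ → ≈-sym (assoc _ _ _)
      })
    (≅-sym (⊙-graph assocʳ′ assocˡ′ (λ _ → refl) (λ _ → refl))))

  swap-natural : {F : Triskell (X × X′)} {G : Triskell (Y × Y′)} →
    graph (pair swap) ⊙ₜ (F ⊗ₜ G) ≅ (G ⊗ₜ F) ⊙ₜ graph (pair swap)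
  swap-natural = ≅-trans (graph-⊙ _) (≅-trans
    (record
      { edges = mk↔ₛ′ swap swap (λ _ → refl) (λ _ → refl)
      ; s-≡ = λ _ → refl
      ; t-≡ = λ _ → refl
      ; w-≈ = λ _ → comm _ _
      })
    (≅-sym (⊙-graph swap swap (λ _ → refl) (λ _ → refl))))

  proj₂-natural : {F : Triskell (X × Y)} →
    graph (pair proj₂) ⊙ₜ (Idₜ (⊤ {a}) ⊗ₜ F) ≅ F ⊙ₜ graph (pair proj₂)
  proj₂-natural = ≅-trans (graph-⊙ _) (≅-trans
    (record
      { edges = mk↔ₛ′ proj₂ (_ ,_) (λ _ → refl) (λ _ → refl)
      ; s-≡ = λ _ → refl
      ; t-≡ = λ _ → refl
      ; w-≈ = λ _ → ≈-sym (identityˡ _)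
      })
    (≅-sym (⊙-graph proj₂ (tt ,_) (λ _ → refl) (λ _ → refl))))

  proj₁-natural : {F : Triskell (X × Y)} →
    graph (pair proj₁) ⊙ₜ (F ⊗ₜ Idₜ (⊤ {a})) ≅ F ⊙ₜ graph (pair proj₁)
  proj₁-natural = ≅-trans (graph-⊙ _) (≅-trans
    (record
      { edges = mk↔ₛ′ proj₁ (_, _) (λ _ → refl) (λ _ → refl)
      ; s-≡ = λ _ → refl
      ; t-≡ = λ _ → refl
      ; w-≈ = λ _ → ≈-sym (identityʳ _)
      })
    (≅-sym (⊙-graph proj₁ (_, tt) (λ _ → refl) (λ _ → refl))))

  -- Currying and evaluation.

  curryₜ : Triskell ((Z × X) × Y) → Triskell (Z × (X × Y))
  curryₜ = reindex (pair assocʳ′)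

  uncurryₜ : Triskell (Z × (X × Y)) → Triskell ((Z × X) × Y)
  uncurryₜ = reindex (pair assocˡ′)

  evalₜ : (X Y : Set a) → Triskell (((X × Y) × X) × Y)
  evalₜ X Y = uncurryₜ (Idₜ (X × Y))

  -- The edges of both identities involved are forced by the edge of `G`, which alone remains free.
  evalₜ-⊗ : {G : Triskell (Z × (X × Y))} → evalₜ X Y ⊙ₜ (G ⊗ₜ Idₜ X) ≅ uncurryₜ G
  evalₜ-⊗ = record
    { edges = mk↔ₛ′ (λ ((_ , (g , _)) , _) → g) (λ g → (_ , (g , _)) , refl , refl)
        (λ _ → refl) (λ { (_ , refl , refl) → refl })
    ; s-≡ = λ { (_ , refl , refl) → refl }
    ; t-≡ = λ { (_ , refl , refl) → refl }
    ; w-≈ = λ _ → ≈-sym (≈-trans (identityˡ _) (identityʳ _))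
    }

  []-curry : {F : Triskell ((X × Y) × Z)} → [ [ curryₜ F ] T ] U ≅ [ F ] (T ×ₜ U)
  []-curry = record
    { edges = mk↔ₛ′
        (λ ((((f , e) , p , q) , e′) , p′ , q′) →
          (f , (e , e′)) , cong₂ _,_ p p′ , cong₂ _,_ q q′)
        (λ ((f , (e , e′)) , p , q) →
          (((f , e) , cong proj₁ p , cong proj₁ q) , e′) , cong proj₂ p , cong proj₂ q)
        (λ _ → Σ-≡ pair-uip refl)
        (λ (((d , _) , e′) , _) →
          -- The matching proofs sit at two depths of the nested pair, so irrelevance is applied to
          -- each separately.
          cong₂ (λ r r′ → ((d , r) , e′) , r′) (pair-uip _ _) (pair-uip _ _))
    ; s-≡ = λ _ → refl
    ; t-≡ = λ _ → refl
    ; w-≈ = λ _ → ≈-sym (assoc _ _ _)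
    }

  -- The trace pairing and its adjunctions.

  transpose : X × X → (X × ⊤ {a}) × (X × ⊤ {a})
  transpose (x , x′) = (x′ , tt) , (x , tt)

  untranspose : (X × ⊤ {a}) × (X × ⊤ {a}) → X × X
  untranspose ((x , _) , (x′ , _)) = x′ , x

  -- [ form T ] U is a triskell over ⊤ with the edges that tr (T ∘ₜ U) sums over.
  form : Triskell X → Triskell (X × ⊤ {a})
  form = reindex transpose

  unform : Triskell (X × ⊤ {a}) → Triskell X
  unform = reindex untranspose

  -- Cyclicity of the trace: a closed path of two edges can be read from either of them, and
  -- commutativity of Ω equates the weights.
  form-sym : [ form T ] U ≅ [ form U ] T
  form-sym = record
    { edges = mk↔ₛ′ (λ ((e , e′) , p , q) → (e′ , e) , sym q , sym p)
        (λ ((e′ , e) , p , q) → (e , e′) , sym q , sym p)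
        (λ _ → Σ-≡ pair-uip refl) (λ _ → Σ-≡ pair-uip refl)
    ; s-≡ = λ _ → refl
    ; t-≡ = λ _ → refl
    ; w-≈ = λ _ → comm _ _
    }

  -- The dual morphism F° of the compact closed structure: it exchanges the two ends, and also
  -- source with target.
  adjoint : Triskell (X × Y) → Triskell (Y × X)
  adjoint = reindex λ ((x , y) , (x′ , y′)) → (y′ , x′) , (y , x)

  form-⊙ : {F : Triskell (X × Y)} → form T ⊙ₜ F ≅ form ([ adjoint F ] T)
  form-⊙ = record
    { edges = mk↔ₛ′ (λ ((e , f) , p , q) → (f , e) , sym q , sym p)
        (λ ((f , e) , p , q) → (e , f) , sym q , sym p)
        (λ _ → Σ-≡ pair-uip refl) (λ _ → Σ-≡ pair-uip refl)
    ; s-≡ = λ _ → refl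
    ; t-≡ = λ _ → refl
    ; w-≈ = λ _ → comm _ _
    }

  form-[] : {F : Triskell (X × Y)} →
            [ form T ] ([ F ] U) ≅ [ form ([ adjoint F ] T) ] U
  form-[] = ≅-trans (≅-sym []-⊙) ([]-cong form-⊙ ≅-refl)

  -- Testing `[ F ] T` against `U` is testing `F` against a product. `T` enters that product
  -- transposed because application uses its edges covariantly. This presents a hom-set as an
  -- orthogonal.
  form-⊸ : {F : Triskell (X × Y)} →
           [ form (reindex (first swap) (T ×ₜ U)) ] F ≅ [ form U ] ([ F ] T)
  form-⊸ = record
    { edges = mk↔ₛ′
        (λ (((e , e′) , f) , p , q) →
          (e′ , ((f , e) , sym (cong proj₁ p) , sym (cong proj₁ q))) , cong proj₂ p , cong proj₂ q)
        (λ ((e′ , ((f , e) , p , q)) , p′ , q′) →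
          ((e , e′) , f) , cong₂ _,_ (sym p) p′ , cong₂ _,_ (sym q) q′)
        (λ ((e′ , (d , _)) , _) →
          cong₂ (λ r r′ → (e′ , (d , r)) , r′) (pair-uip _ _) (pair-uip _ _))
        (λ _ → Σ-≡ pair-uip refl)
    ; s-≡ = λ _ → refl
    ; t-≡ = λ _ → refl
    ; w-≈ = λ _ → ≈-sym (xy∙z≈y∙zx _ _ _)
    }

  -- The exchange of source and target made by `form` on the left is made on `T` instead on the
  -- right. Elements of the bidual can hence be tested as bipolar elements.
  form-bidual : {V : Triskell ((X × ⊤ {a}) × ⊤ {a})} →
    [ form (reindex (pair (proj₁ ∘ proj₁)) V) ] T ≅ [ V ] (form T)
  form-bidual = record
    { edges = mk↔ₛ′
        (λ (d , p , q) → d , cong (_, tt) q , cong (_, tt) p)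
        (λ (d , p , q) → d , cong proj₁ q , cong proj₁ p)
        (λ _ → Σ-≡ pair-uip refl) (λ _ → Σ-≡ pair-uip refl)
    ; s-≡ = λ _ → refl
    ; t-≡ = λ _ → refl
    ; w-≈ = λ _ → ≈-refl
    }

  -- The tensor unit, the bidual map and the coherence laws.

  unit : Triskell (⊤ {a})
  unit = record { Edge = ⊤ ; s = id ; t = id ; w = λ _ → Monoid.ε Ω }

  -- Over a one-point web the matching conditions are void and `unit` contributes only the weight ε.
  form-unit : {T : Triskell (⊤ {a})} → [ form T ] unit ≅ T
  form-unit = record
    { edges = mk↔ₛ′ (λ ((e , _) , _) → e) (λ e → (e , tt) , refl , refl)
        (λ _ → refl) (λ _ → Σ-≡ pair-uip refl)
    ; s-≡ = λ _ → refl
    ; t-≡ = λ _ → refl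
    ; w-≈ = λ _ → ≈-sym (identityʳ _)
    }

  unit-×ˡ : reindex (pair proj₂) (unit ×ₜ T) ≅ T
  unit-×ˡ = record
    { edges = mk↔ₛ′ proj₂ (tt ,_) (λ _ → refl) (λ _ → refl)
    ; s-≡ = λ _ → refl
    ; t-≡ = λ _ → refl
    ; w-≈ = λ _ → ≈-sym (identityˡ _)
    }

  unit-×ʳ : reindex (pair proj₁) (T ×ₜ unit) ≅ T
  unit-×ʳ = record
    { edges = mk↔ₛ′ proj₁ (_, tt) (λ _ → refl) (λ _ → refl)
    ; s-≡ = λ _ → refl
    ; t-≡ = λ _ → refl
    ; w-≈ = λ _ → ≈-sym (identityʳ _)
    }

  bidual : X → (X × ⊤ {a}) × ⊤ {a}
  bidual x = (x , tt) , tt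

  -- The canonical map to the bidual is the graph of a map of webs. That map is bijective because
  -- `⊤` is a point, whence the dualising property.
  curry-eval-swap : curryₜ (evalₜ X (⊤ {a}) ⊙ₜ graph (pair swap)) ≅ graph (pair bidual)
  curry-eval-swap = ≅-trans
    (reindex-cong (pair assocʳ′) (⊙-graph swap swap (λ _ → refl) (λ _ → refl)))
    (record
      { edges = mk↔ₛ′ (pair proj₁) (pair (_, tt)) (λ _ → refl) (λ _ → refl)
      ; s-≡ = λ _ → refl
      ; t-≡ = λ _ → refl
      ; w-≈ = λ _ → ≈-refl
      })

  -- As in `pentagon` and `hexagon`, `graph-⊗` and `graph-∘` collapse each side to a single graph;
  -- the two maps of webs then agree by computation.
  triangle : (Idₜ X ⊗ₜ graph (pair proj₂)) ⊙ₜ graph (pair assocʳ′) ≅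
             graph (pair (proj₁ {A = X} {B = λ _ → ⊤ {a}})) ⊗ₜ Idₜ Y
  triangle = ≅-trans (⊙-cong (graph-⊗ id proj₂) ≅-refl)
    (≅-trans (graph-∘ (pair assocʳ′) (pair (map id proj₂))) (≅-sym (graph-⊗ proj₁ id)))

  pentagon : {A B C D : Set a} →
    (Idₜ A ⊗ₜ graph (pair (assocʳ′ {A = B} {C = D}))) ⊙ₜ
      (graph (pair assocʳ′) ⊙ₜ
        (graph (pair (assocʳ′ {A = A} {B = B} {C = C})) ⊗ₜ Idₜ D)) ≅
    graph (pair assocʳ′) ⊙ₜ graph (pair assocʳ′)
  pentagon = ≅-trans
    (⊙-cong (graph-⊗ id assocʳ′) (≅-trans (⊙-cong ≅-refl (graph-⊗ assocʳ′ id))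
      (graph-∘ (pair (map assocʳ′ id)) (pair assocʳ′))))
    (≅-trans (graph-∘ (pair (assocʳ′ ∘ map assocʳ′ id)) (pair (map id assocʳ′)))
      (≅-sym (graph-∘ (pair assocʳ′) (pair assocʳ′))))

  hexagon : {A B C : Set a} →
    (Idₜ B ⊗ₜ graph (pair (swap {A = A} {B = C}))) ⊙ₜ
      (graph (pair assocʳ′) ⊙ₜ (graph (pair (swap {A = A} {B = B})) ⊗ₜ Idₜ C)) ≅
    graph (pair assocʳ′) ⊙ₜ (graph (pair swap) ⊙ₜ graph (pair assocʳ′))
  hexagon = ≅-trans
    (⊙-cong (graph-⊗ id swap) (≅-trans (⊙-cong ≅-refl (graph-⊗ swap id))
      (graph-∘ (pair (map swap id)) (pair assocʳ′))))
    (≅-trans (graph-∘ (pair (assocʳ′ ∘ map swap id)) (pair (map id swap)))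
      (≅-sym (≅-trans (⊙-cong ≅-refl (graph-∘ (pair assocʳ′) (pair swap)))
        (graph-∘ (pair (swap ∘ assocʳ′)) (pair assocʳ′)))))

module Model {c ℓ a k ℓK p : Level}
  (Ω : Monoid c ℓ) (comm : Commutative (Monoid._≈_ Ω) (Monoid._∙_ Ω))
  (K : CompleteMonoid a k ℓK)
  (m : Func (Monoid.setoid Ω) (CompleteMonoid.setoid K))
  (Pole : Pred (CompleteMonoid.Carrier K) p)
  (resp : Pole Respects (CompleteMonoid._≈_ K)) where

  open QuantitativeCoherence Ω K m Pole
  open TriskellProperties a Ω comm
  open CompleteMonoid K using (∑; ∑-cong; ∑-↔) renaming (sym to ≈-sym; trans to ≈-trans)

  -- Orthogonality expressed through the pairing.

  total : Triskell (⊤ {a}) → CompleteMonoid.Carrier K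
  total T = ∑ λ e → Func.to m (w T e)

  total-resp : {T U : Triskell ⊤} → T ≅ U → total T ∈ Pole → total U ∈ Pole
  total-resp φ = resp (≈-trans
    (∑-cong (λ e → ≈-sym (Func.cong m (_≅_.w-≈ φ e)))) (∑-↔ (_≅_.edges φ) _))

  module _ {T U : Triskell X} where
    -- A loop of `T ∘ₜ U` matches targets with sources, whereas application matches source with
    -- source and target with target. The exchange inside `form` reconciles them, so both sides hold
    -- the same data.
    tr-↔ : Σ (Edge (T ∘ₜ U)) (λ e → s (T ∘ₜ U) e ≡ t (T ∘ₜ U) e) ↔ Edge ([ form T ] U)
    tr-↔ = mk↔ₛ′ (λ ((d , p) , q) → d , p , q) (λ (d , p , q) → (d , p) , q)
      (λ _ → refl) (λ _ → refl)

    ⊥⇒total : T ⊥ₜ U → total ([ form T ] U) ∈ Pole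
    ⊥⇒total = resp (∑-↔ tr-↔ _)

    total⇒⊥ : total ([ form T ] U) ∈ Pole → T ⊥ₜ U
    total⇒⊥ = resp (≈-sym (∑-↔ tr-↔ _))

  -- The two webs may differ, so every isomorphism between pairings becomes a transfer of
  -- orthogonality.
  ⊥-resp : {T U : Triskell X} {T′ U′ : Triskell Y} →
           [ form T ] U ≅ [ form T′ ] U′ → T ⊥ₜ U → T′ ⊥ₜ U′
  ⊥-resp φ T⊥U = total⇒⊥ (total-resp φ (⊥⇒total T⊥U))

  ⊥-sym : {T U : Triskell X} → T ⊥ₜ U → U ⊥ₜ T
  ⊥-sym = ⊥-resp form-sym

  -- Bipolar closure and the spaces of the model.

  ⊥⊥-intro : {S : Pred (Triskell X) L} → S ⊆ (S ^⊥) ^⊥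
  ⊥⊥-intro T∈ A A∈ = ⊥-sym (A∈ _ T∈)

  -- A triple orthogonal is a single one. Duals, tensors and the unit are defined as orthogonals and
  -- so are covered at once.
  ^⊥-closed : {S : Pred (Triskell X) L} → IsQCS ⟨ X , S ^⊥ ⟩
  ^⊥-closed = ⊥⊥-intro , λ T∈ A A∈ → T∈ A (⊥⊥-intro A∈)

  elements : (A : QCS) → Pred (Triskell (Web (proj₁ A))) L
  elements (A , _) = Set𝐀 A

  ≅-closed : (A : QCS) {T U : Triskell (Web (proj₁ A))} →
             T ≅ U → T ∈ elements A → U ∈ elements A
  ≅-closed (_ , qA) φ T∈ = proj₂ qA λ B B∈ →
    ⊥-resp ([]-cong (reindex-cong transpose φ) ≅-refl) (proj₁ qA T∈ B B∈)

  -- A ⊸ B is the orthogonal of the products of A and B^⊥, up to transposition in A.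
  ⊸-closed : (A B : QCS) → IsQCS (proj₁ A ⊸ proj₁ B)
  ⊸-closed _ (_ , qB) = ⊥⊥-intro , λ {F} F∈ T T∈ → proj₂ qB λ U U∈ →
    ⊥-sym (⊥-resp form-⊸ (⊥-sym (F∈ (reindex (first swap) (T ×ₜ U)) λ G G∈ →
      ⊥-resp (≅-sym form-⊸) (⊥-sym (proj₁ qB (G∈ T T∈) U U∈)))))

  infixr 10 _⊗Q_
  _⊗Q_ : QCS → QCS → QCS
  (A , _) ⊗Q (B , _) = A ⊗ B , ^⊥-closed

  infixr 9 _⊸Q_
  _⊸Q_ : QCS → QCS → QCS
  A ⊸Q B = proj₁ A ⊸ proj₁ B , ⊸-closed A B

  infix 12 _*Q
  _*Q : QCS → QCS
  (A , _) *Q = dual A , ^⊥-closed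

  units : Pred (Triskell (⊤ {a})) L
  units T = Lift L (T ≅ unit)

  𝟏Q : QCS
  𝟏Q = ⟨ ⊤ , (units ^⊥) ^⊥ ⟩ , ^⊥-closed

  -- For `V` orthogonal to `C`, the adjunction `form-[]` moves `F` across the pairing. Used on `S`,
  -- it shows that `[ adjoint F ] V` lies in `S ^⊥`; used on `U`, it then gives that `[ F ] U` is
  -- orthogonal to `V`.
  ⊥⊥-elim : {S : Pred (Triskell X) L} (C : QCS) (F : Triskell (X × Web (proj₁ C))) →
            (∀ T → T ∈ S → [ F ] T ∈ elements C) →
            ∀ T → T ∈ (S ^⊥) ^⊥ → [ F ] T ∈ elements C
  ⊥⊥-elim (_ , qC) F F∈ U U∈ = proj₂ qC λ V V∈ → ⊥-sym (⊥-resp (≅-sym form-[])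
    (⊥-sym (U∈ ([ adjoint F ] V) λ T T∈ →
      ⊥-resp form-[] (⊥-sym (proj₁ qC (F∈ T T∈) V V∈)))))

  ⊗-intro : (A B : QCS) → ∀ T → T ∈ elements A → ∀ U → U ∈ elements B →
            T ×ₜ U ∈ elements (A ⊗Q B)
  ⊗-intro A B T T∈ U U∈ = ⊥⊥-intro (T , U , T∈ , U∈ , ≅-refl)

  ⊗-elim : (A B C : QCS) (F : Triskell _) →
           (∀ T → T ∈ elements A → ∀ U → U ∈ elements B → [ F ] (T ×ₜ U) ∈ elements C) →
           F ∈ elements (A ⊗Q B ⊸Q C)
  ⊗-elim A B C F F∈ = ⊥⊥-elim C F λ { V (T , U , T∈ , U∈ , φ) →
    ≅-closed C ([]-cong ≅-refl (≅-sym φ)) (F∈ T T∈ U U∈) }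

  curry-closed : (A B C : QCS) {F : Triskell _} →
                 F ∈ elements (C ⊗Q A ⊸Q B) → curryₜ F ∈ elements (C ⊸Q (A ⊸Q B))
  curry-closed A B C F∈ T T∈ U U∈ =
    ≅-closed B (≅-sym []-curry) (F∈ (T ×ₜ U) (⊗-intro C A T T∈ U U∈))

  uncurry-closed : (A B C : QCS) {F : Triskell _} →
                   F ∈ elements (C ⊸Q (A ⊸Q B)) → uncurryₜ F ∈ elements (C ⊗Q A ⊸Q B)
  uncurry-closed A B C {F} F∈ = ⊗-elim C A B (uncurryₜ F) λ T T∈ U U∈ →
    ≅-closed B []-curry (F∈ T T∈ U U∈)

  -- Currying the third argument away exposes the inner tensor as the sole source, so that `⊗-elim`
  -- applies to it. `⊗-elimʳ` fixes the first argument instead.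
  ⊗-elimˡ : (A B C D : QCS) (F : Triskell _) →
    (∀ T → T ∈ elements A → ∀ U → U ∈ elements B → ∀ V → V ∈ elements C →
      [ F ] ((T ×ₜ U) ×ₜ V) ∈ elements D) →
    F ∈ elements ((A ⊗Q B) ⊗Q C ⊸Q D)
  ⊗-elimˡ A B C D F F∈ = uncurry-closed C D (A ⊗Q B)
    (⊗-elim A B (C ⊸Q D) (curryₜ F) λ T T∈ U U∈ V V∈ →
      ≅-closed D (≅-sym []-curry) (F∈ T T∈ U U∈ V V∈))

  ⊗-elimʳ : (A B C D : QCS) (F : Triskell _) →
    (∀ T → T ∈ elements A → ∀ U → U ∈ elements B → ∀ V → V ∈ elements C →
      [ F ] (T ×ₜ (U ×ₜ V)) ∈ elements D) →
    F ∈ elements (A ⊗Q (B ⊗Q C) ⊸Q D)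
  ⊗-elimʳ A B C D F F∈ = uncurry-closed (B ⊗Q C) D A λ T T∈ →
    ⊗-elim B C D ([ curryₜ F ] T) λ U U∈ V V∈ →
      ≅-closed D (≅-sym []-curry) (F∈ T T∈ U U∈ V V∈)

  -- Membership of the structural morphisms in their hom-sets.

  graph-elements : (A : QCS) (φ : X × X → _) {T : Triskell X} →
                   reindex φ T ∈ elements A → [ graph φ ] T ∈ elements A
  graph-elements A φ = ≅-closed A (≅-sym ([]-graph φ))

  Id-closed : (A : QCS) → Idₜ _ ∈ elements (A ⊸Q A)
  Id-closed A T T∈ = ≅-closed A (≅-sym []-Id) T∈

  ⊙-closed : (A B C : QCS) {F : Triskell _} {G : Triskell _} → G ∈ elements (B ⊸Q C) →
             F ∈ elements (A ⊸Q B) → G ⊙ₜ F ∈ elements (A ⊸Q C)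
  ⊙-closed A B C G∈ F∈ T T∈ = ≅-closed C (≅-sym []-⊙) (G∈ _ (F∈ T T∈))

  ⊗ₜ-closed : (A A′ B B′ : QCS) {F : Triskell _} {G : Triskell _} → F ∈ elements (A ⊸Q B) →
              G ∈ elements (A′ ⊸Q B′) → F ⊗ₜ G ∈ elements (A ⊗Q A′ ⊸Q B ⊗Q B′)
  ⊗ₜ-closed A A′ B B′ {F} {G} F∈ G∈ = ⊗-elim A A′ (B ⊗Q B′) (F ⊗ₜ G) λ T T∈ U U∈ →
    ≅-closed (B ⊗Q B′) (≅-sym []-⊗) (⊗-intro B B′ _ (F∈ T T∈) _ (G∈ U U∈))

  unit∈ : unit ∈ elements 𝟏Q
  unit∈ = ⊥⊥-intro (lift ≅-refl)

  assocʳ-closed : (A B C : QCS) →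
    graph (pair assocʳ′) ∈ elements ((A ⊗Q B) ⊗Q C ⊸Q A ⊗Q (B ⊗Q C))
  assocʳ-closed A B C = ⊗-elimˡ A B C A[BC] (graph (pair assocʳ′)) λ T T∈ U U∈ V V∈ →
    graph-elements A[BC] (pair assocʳ′) (≅-closed A[BC] (≅-sym ×ₜ-assoc)
      (⊗-intro A (B ⊗Q C) T T∈ (U ×ₜ V) (⊗-intro B C U U∈ V V∈)))
    where A[BC] = A ⊗Q (B ⊗Q C)

  assocˡ-closed : (A B C : QCS) →
    graph (pair assocˡ′) ∈ elements (A ⊗Q (B ⊗Q C) ⊸Q (A ⊗Q B) ⊗Q C)
  assocˡ-closed A B C = ⊗-elimʳ A B C [AB]C (graph (pair assocˡ′)) λ T T∈ U U∈ V V∈ →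
    -- Rebracketing back and forth is the identity by computation, so `×ₜ-assoc` reindexed along
    -- `assocˡ′` is the isomorphism wanted.
    graph-elements [AB]C (pair assocˡ′) (≅-closed [AB]C (reindex-cong (pair assocˡ′) ×ₜ-assoc)
      (⊗-intro (A ⊗Q B) C (T ×ₜ U) (⊗-intro A B T T∈ U U∈) V V∈))
    where [AB]C = (A ⊗Q B) ⊗Q C

  swap-closed : (A B : QCS) → graph (pair swap) ∈ elements (A ⊗Q B ⊸Q B ⊗Q A)
  swap-closed A B = ⊗-elim A B (B ⊗Q A) (graph (pair swap)) λ T T∈ U U∈ →
    graph-elements (B ⊗Q A) (pair swap)
      (≅-closed (B ⊗Q A) (≅-sym ×ₜ-comm) (⊗-intro B A U U∈ T T∈))

  -- Once curried, the map has source `𝟏Q`, the bipolar of `units`, and is tested on copies of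
  -- `unit` alone.
  proj₂-closed : (A : QCS) → graph (pair proj₂) ∈ elements (𝟏Q ⊗Q A ⊸Q A)
  proj₂-closed A = uncurry-closed A A 𝟏Q
    (⊥⊥-elim (A ⊸Q A) (curryₜ (graph (pair proj₂))) λ { T (lift φ) U U∈ →
      ≅-closed A (≅-sym ([]-curry {F = graph (pair proj₂)})) (graph-elements A (pair proj₂)
        (≅-closed A (≅-sym (≅-trans (reindex-cong (pair proj₂) (×ₜ-cong φ ≅-refl)) unit-×ˡ)) U∈)) })

  proj₁-closed : (A : QCS) → graph (pair proj₁) ∈ elements (A ⊗Q 𝟏Q ⊸Q A)
  proj₁-closed A = uncurry-closed 𝟏Q A A λ T T∈ →
    ⊥⊥-elim A ([ curryₜ (graph (pair proj₁)) ] T) λ { U (lift φ) →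
      ≅-closed A (≅-sym ([]-curry {F = graph (pair proj₁)})) (graph-elements A (pair proj₁)
        (≅-closed A (≅-sym (≅-trans (reindex-cong (pair proj₁) (×ₜ-cong ≅-refl φ)) unit-×ʳ)) T∈)) }

  unit-,-closed : (A : QCS) → graph (pair (tt ,_)) ∈ elements (A ⊸Q 𝟏Q ⊗Q A)
  unit-,-closed A T T∈ = graph-elements (𝟏Q ⊗Q A) (pair (tt ,_)) {T}
    (≅-closed (𝟏Q ⊗Q A) (reindex-cong (pair (tt ,_)) unit-×ˡ) (⊗-intro 𝟏Q A unit unit∈ T T∈))

  ,-unit-closed : (A : QCS) → graph (pair (_, tt)) ∈ elements (A ⊸Q A ⊗Q 𝟏Q)
  ,-unit-closed A T T∈ = graph-elements (A ⊗Q 𝟏Q) (pair (_, tt)) {T}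
    (≅-closed (A ⊗Q 𝟏Q) (reindex-cong (pair (_, tt)) unit-×ʳ) (⊗-intro A 𝟏Q T T∈ unit unit∈))

  -- The dualising object and the duality.

  total⇒𝟏* : {T : Triskell ⊤} → total T ∈ Pole → T ∈ elements (𝟏Q *Q)
  total⇒𝟏* T∈ = ⊥⊥-intro λ { U (lift φ) → total⇒⊥
    (total-resp (≅-sym (≅-trans ([]-cong ≅-refl φ) form-unit)) T∈) }

  -- With `total⇒𝟏*`, this identifies the elements of the dualising object as the triskells with
  -- total in the pole. Maps into that object therefore express orthogonality.
  𝟏*⇒total : {T : Triskell ⊤} → T ∈ elements (𝟏Q *Q) → total T ∈ Pole
  𝟏*⇒total T∈ = total-resp form-unit (⊥⇒total (T∈ unit unit∈))

  form-closed : (A : QCS) {T : Triskell _} →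
                T ∈ elements (A *Q) → form T ∈ elements (A ⊸Q 𝟏Q *Q)
  form-closed A T∈ U U∈ = total⇒𝟏* (⊥⇒total (T∈ U U∈))

  unform-closed : (A : QCS) {T : Triskell _} →
                  T ∈ elements (A ⊸Q 𝟏Q *Q) → unform T ∈ elements (A *Q)
  unform-closed A T∈ U U∈ = total⇒⊥ (𝟏*⇒total (T∈ U U∈))

  transpose-closed : (A : QCS) → graph transpose ∈ elements (A *Q ⊸Q (A ⊸Q 𝟏Q *Q))
  transpose-closed A T T∈ = graph-elements (A ⊸Q 𝟏Q *Q) transpose (form-closed A T∈)

  untranspose-closed : (A : QCS) → graph untranspose ∈ elements ((A ⊸Q 𝟏Q *Q) ⊸Q A *Q)
  untranspose-closed A T T∈ = graph-elements (A *Q) untranspose (unform-closed A T∈)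

  -- By bipolar closure of `A` the collapse of `V` is tested on `T` in the dual of `A`. There
  -- `form-bidual` turns the pairing into `V` applied to `form T`, whose total is in the pole.
  unbidual-closed : (A : QCS) →
    graph (pair (proj₁ ∘ proj₁)) ∈ elements (((A ⊸Q 𝟏Q *Q) ⊸Q 𝟏Q *Q) ⊸Q A)
  unbidual-closed A V V∈ = graph-elements A (pair (proj₁ ∘ proj₁))
    (proj₂ (proj₂ A) λ T T∈ → total⇒⊥ (total-resp (≅-sym form-bidual)
      (𝟏*⇒total (V∈ (form T) (form-closed A T∈)))))

  eval-closed : (A B : QCS) → evalₜ _ _ ∈ elements ((A ⊸Q B) ⊗Q A ⊸Q B)
  eval-closed A B = uncurry-closed A B (A ⊸Q B) (Id-closed (A ⊸Q B))

  -- Assembly of the star-autonomous category.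

  isModelOfMLL : IsModelOfMLL
  isModelOfMLL = record
    { dual-closed = λ _ → ^⊥-closed
    ; ⊗-closed    = λ _ _ → ^⊥-closed
    ; ⊸-closed    = λ qA qB → ⊸-closed (_ , qA) (_ , qB)
    ; Id-closed   = λ qA → Id-closed (_ , qA)
    ; ⊙-closed    = λ qA qB qC {F} {G} → ⊙-closed (_ , qA) (_ , qB) (_ , qC) {F} {G}
    ; isStarAutonomous = record
      { isCategory = record
        { equiv = record { refl = ≅-refl ; sym = ≅-sym ; trans = ≅-trans }
        ; ⊙-cong = ⊙-cong
        ; assoc = λ {_} {_} {_} {_} {F} {G} {H} →
            ⊙-assoc {F = proj₁ F} {G = proj₁ G} {H = proj₁ H}
        ; identityˡ = ⊙-identityˡ
        ; identityʳ = ⊙-identityʳ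
        }
      ; isSymmetricMonoidal = record
        { _⊗₁_ = λ {A} {A′} {B} {B′} (F , F∈) (G , G∈) →
            F ⊗ₜ G , ⊗ₜ-closed A A′ B B′ {F} {G} F∈ G∈
        ; ⊗-cong = ⊗-cong
        ; ⊗-id = ⊗-id
        ; ⊗-⊙ = λ {_} {_} {_} {_} {_} {_} {F} {G} {F′} {G′} →
            ⊗-⊙ {F = proj₁ F} {G = proj₁ G} {F′ = proj₁ F′} {G′ = proj₁ G′}
        ; 𝟏 = 𝟏Q
        ; α = λ {A} {B} {C} → graph (pair assocʳ′) , assocʳ-closed A B C
        ; λˡ = λ {A} → graph (pair proj₂) , proj₂-closed A
        ; ρ = λ {A} → graph (pair proj₁) , proj₁-closed A
        ; σ = λ {A} {B} → graph (pair swap) , swap-closed A B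
        ; α-iso = λ {A} {B} {C} → record
          { inv = graph (pair assocˡ′) , assocˡ-closed A B C
          ; invˡ = graph-∘ (pair assocʳ′) (pair assocˡ′)
          ; invʳ = graph-∘ (pair assocˡ′) (pair assocʳ′)
          }
        ; λˡ-iso = λ {A} → record
          { inv = graph (pair (tt ,_)) , unit-,-closed A
          ; invˡ = graph-∘ (pair proj₂) (pair (tt ,_))
          ; invʳ = graph-∘ (pair (tt ,_)) (pair proj₂)
          }
        ; ρ-iso = λ {A} → record
          { inv = graph (pair (_, tt)) , ,-unit-closed A
          ; invˡ = graph-∘ (pair proj₁) (pair (_, tt))
          ; invʳ = graph-∘ (pair (_, tt)) (pair proj₁)
          }
        ; α-natural = assoc-natural
        ; λˡ-natural = proj₂-natural
        ; ρ-natural = proj₁-natural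
        ; σ-natural = swap-natural
        ; triangle = triangle
        ; pentagon = pentagon
        ; hexagon = hexagon
        ; involutive = graph-∘ (pair swap) (pair swap)
        }
      ; eval = λ {A} {B} → evalₜ _ _ , eval-closed A B
      ; curry = λ {A} {B} {C} (F , F∈) → curryₜ F , curry-closed A B C {F} F∈
      ; curry-β = evalₜ-⊗
      ; curry-unique = λ {A} {B} {C} {F} {G} φ →
          -- `curryₜ (uncurryₜ G)` is `G` by computation, so currying the isomorphism of
          -- `uncurryₜ G` with the given morphism suffices.
          reindex-cong (pair assocʳ′) (≅-trans (≅-sym (evalₜ-⊗ {G = proj₁ G})) φ)
      ; dualising = λ {A} → record
        { inv = graph (pair (proj₁ ∘ proj₁)) , unbidual-closed A
        ; invˡ = ≅-trans (⊙-cong ≅-refl curry-eval-swap)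
            (graph-∘ (pair bidual) (pair (proj₁ ∘ proj₁)))
        ; invʳ = ≅-trans (⊙-cong curry-eval-swap ≅-refl)
            (graph-∘ (pair (proj₁ ∘ proj₁)) (pair bidual))
        }
      ; *-⇒⊸ = λ {A} → graph transpose , transpose-closed A
      ; *-⇒⊸-iso = λ {A} → record
        { inv = graph untranspose , untranspose-closed A
        ; invˡ = graph-∘ transpose untranspose
        ; invʳ = graph-∘ untranspose transpose
        }
      }
    }

theorem32 : {c ℓ a k ℓK p : Level}
    (Ω : Monoid c ℓ) → Commutative (Monoid._≈_ Ω) (Monoid._∙_ Ω) →
    (K : CompleteMonoid a k ℓK)
    (m : Func (Monoid.setoid Ω) (CompleteMonoid.setoid K))
    (Pole : Pred (CompleteMonoid.Carrier K) p) →
    Pole Respects (CompleteMonoid._≈_ K) →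
    QuantitativeCoherence.IsModelOfMLL Ω K m Pole
theorem32 = Model.isModelOfMLL
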